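{- For any formula $\varphi\in\mathcal{L}$, it is decidable whether or not $\vdash_{\mathsf{IM}}\varphi$. (That is, the set of theorems of $\mathsf{IM}$ is decidable.)
   Context: Language: $\mathcal{L}$ is generated by $\varphi ::= p \mid \bot \mid \varphi\wedge\varphi \mid \varphi\vee\varphi \mid \varphi\to\varphi \mid \Box\varphi \mid \Diamond\varphi$ with $p$ ranging over a fixed set of proposition letters; $\neg\varphi := \varphi\to\bot$, $\top := \neg\bot$. Logic: $\mathsf{IM}$ is obtained by extending an axiomatisation of intuitionistic propositional logic over $\mathcal{L}$ with the rules "from $\varphi\to\psi$ infer $\Box\varphi\to\Box\psi$" and "from $\varphi\to\psi$ infer $\Diamond\varphi\to\Diamond\psi$" and the axioms $(\Box\varphi\wedge\Diamond\neg\varphi)\to\bot$ and $(\Box\top\to\Diamond\varphi)\to\Diamond\varphi$, closed under modus ponens and uniform substitution. $\vdash_{\mathsf{IM}}\varphi$ means that $\varphi$ is a theorem of $\mathsf{IM}$. -}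

module Defs where

infixr 8 □_ ◇_ ∼_
infixr 7 _∧_
infixr 6 _∨_
infixr 5 _⇒_
infix  3 ⊢IM_

data Formula (Atom : Set) : Set where
  var         : Atom → Formula Atom
  bot         : Formula Atom
  _∧_ _∨_ _⇒_ : Formula Atom → Formula Atom → Formula Atom
  □_ ◇_       : Formula Atom → Formula Atom

∼_ : ∀ {Atom} → Formula Atom → Formula Atom
∼ φ = φ ⇒ bot

top : ∀ {Atom} → Formula Atom
top = ∼ bot

sub : ∀ {Atom} → (Atom → Formula Atom) → Formula Atom → Formula Atom
sub σ (var p) = σ p
sub σ bot     = bot
sub σ (φ ∧ ψ) = sub σ φ ∧ sub σ ψ
sub σ (φ ∨ ψ) = sub σ φ ∨ sub σ ψ
sub σ (φ ⇒ ψ) = sub σ φ ⇒ sub σ ψ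
sub σ (□ φ)   = □ sub σ φ
sub σ (◇ φ)   = ◇ sub σ φ

-- The axioms are schematic, so that they are the intended ones for every
-- choice of Atom, including finite or empty ones.  There is no necessitation
-- rule: □ and ◇ are only assumed to be monotone.
data ⊢IM_ {Atom : Set} : Formula Atom → Set where
  ⇒-K   : ∀ φ ψ   → ⊢IM φ ⇒ ψ ⇒ φ
  ⇒-S   : ∀ φ ψ χ → ⊢IM (φ ⇒ ψ ⇒ χ) ⇒ (φ ⇒ ψ) ⇒ φ ⇒ χ
  ∧-I   : ∀ φ ψ   → ⊢IM φ ⇒ ψ ⇒ φ ∧ ψ
  ∧-E₁  : ∀ φ ψ   → ⊢IM φ ∧ ψ ⇒ φ
  ∧-E₂  : ∀ φ ψ   → ⊢IM φ ∧ ψ ⇒ ψ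
  ∨-I₁  : ∀ φ ψ   → ⊢IM φ ⇒ φ ∨ ψ
  ∨-I₂  : ∀ φ ψ   → ⊢IM ψ ⇒ φ ∨ ψ
  ∨-E   : ∀ φ ψ χ → ⊢IM (φ ⇒ χ) ⇒ (ψ ⇒ χ) ⇒ φ ∨ ψ ⇒ χ
  bot-E : ∀ φ     → ⊢IM bot ⇒ φ
  □◇-⊥  : ∀ φ     → ⊢IM □ φ ∧ ◇ ∼ φ ⇒ bot
  □⊤-◇  : ∀ φ     → ⊢IM (□ top ⇒ ◇ φ) ⇒ ◇ φ
  mp    : ∀ {φ ψ} → ⊢IM φ ⇒ ψ → ⊢IM φ → ⊢IM ψ
  □-mon : ∀ {φ ψ} → ⊢IM φ ⇒ ψ → ⊢IM □ φ ⇒ □ ψ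
  ◇-mon : ∀ {φ ψ} → ⊢IM φ ⇒ ψ → ⊢IM ◇ φ ⇒ ◇ ψ
  us    : ∀ {φ} (σ : Atom → Formula Atom) → ⊢IM φ → ⊢IM sub σ φ

{-# OPTIONS --safe #-}

-- Natural deduction with general elimination rules, restricted to a finite
-- list Σ of formulas and stratified by height, is decidable at every height;
-- since there are finitely many sequents over Σ, derivability at some height K
-- is closed under all rules.  Sets of contexts that are closed under "every
-- formula of Σ derivable from all extensions in the set is derivable" then
-- form a model of IM in which a formula of Σ holds exactly at the contexts
-- deriving it, so IM-theorems in Σ are derivable at height K.
-- The axiom (□ ⊤ → ◇ φ) → ◇ φ says that ◇ φ is equivalent to □ ⊤ → ◇ φ, which
-- is how ◇ is interpreted.
module Submission where

open import Defs
open import Relation.Nullary using (Dec; yes; no; ¬_; ¬?)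
open import Relation.Nullary.Decidable using (map′; _×-dec_; _⊎-dec_; _→-dec_)
open import Relation.Binary.Definitions using (DecidableEquality)
open import Relation.Binary.PropositionalEquality
  using (_≡_; refl; sym; subst; cong; cong₂)
open import Relation.Unary using (Decidable)
open import Data.Empty using (⊥; ⊥-elim)
open import Data.Unit using (⊤; tt)
open import Data.Nat using (ℕ; zero; suc; _<_)
import Data.Nat.Properties as ℕ
open import Data.Nat.Induction using (<-wellFounded)
open import Induction.WellFounded using (Acc; acc)
open import Data.Product using (Σ-syntax; ∃-syntax; _×_; _,_; proj₁; proj₂; uncurry)
open import Data.Sum as Sum using (_⊎_; inj₁; inj₂)
open import Data.List using (List; []; _∷_; [_]; _++_; length; filter; map; cartesianProduct)
open import Data.List.Properties using (filter-notAll)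
open import Data.List.Membership.Propositional using (_∈_; lose)
open import Data.List.Membership.Propositional.Properties
  using (∈-filter⁺; ∈-filter⁻; ∈-cartesianProduct⁺; ∈-++⁺ˡ; ∈-++⁺ʳ; ∈-map⁺)
open import Data.List.Relation.Binary.Subset.Propositional using (_⊆_)
open import Data.List.Relation.Unary.Any as Any using (Any; here; there; any?)
open import Data.List.Relation.Unary.All as All using (all?)
open import Data.List.Relation.Unary.All.Properties using (¬All⇒Any¬)
open import Function using (id; _∘_)

-- Stabilisation of increasing decidable predicates on a finite list.

-- If stage `k` is not yet stable, filtering drops at least one pending element, so well-founded
-- recursion on the length of the pending list reaches a stable stage.
stabilises : {X : Set} {P : ℕ → X → Set} → (∀ k → Decidable (P k)) →
             (∀ {k x} → P k x → P (suc k) x) → (xs : List X) →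
             ∃[ K ] ∀ {x} → x ∈ xs → P (suc K) x → P K x
stabilises {X} {P} P? mono xs with go 0 xs (<-wellFounded _)
  where
  -- ys lists the elements that may still fail P k.
  go : ∀ k (ys : List X) → Acc _<_ (length ys) →
       ∃[ K ] ∀ {x} → x ∈ ys ⊎ P k x → P (suc K) x → P K x
  go k ys (acc rec) with all? (λ x → P? (suc k) x →-dec P? k x) ys
  ... | yes stable = k , Sum.[ All.lookup stable , (λ p _ → p) ]
  ... | no unstable with go (suc k) ys′ (rec (filter-notAll pending? ys drop))
    where
    pending? = ¬? ∘ P? (suc k)
    ys′ = filter pending? ys
    -- A refuted implication yields only the double negation of its premise, which is the form
    -- `filter-notAll` takes.
    drop : Any (λ x → ¬ ¬ P (suc k) x) ys
    drop = Any.map (λ ¬s ¬p → ¬s (⊥-elim ∘ ¬p))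
                   (¬All⇒Any¬ (λ x → P? (suc k) x →-dec P? k x) ys unstable)
  ...   | K , stable = K , λ m → stable (advance m)
    where
    advance : ∀ {x} → x ∈ ys ⊎ P k x →
              x ∈ filter (¬? ∘ P? (suc k)) ys ⊎ P (suc k) x
    advance (inj₂ p) = inj₂ (mono p)
    advance {x} (inj₁ x∈ys) with P? (suc k) x
    ... | yes p = inj₂ p
    ... | no ¬p = inj₁ (∈-filter⁺ (¬? ∘ P? (suc k)) x∈ys ¬p)
... | K , stable = K , stable ∘ inj₁

sublists : {X : Set} → List X → List (List X)
sublists []       = [ [] ]
sublists (x ∷ xs) = map (x ∷_) (sublists xs) ++ sublists xs

-- Used with membership in a context as `P`: the sublists of `Σ` then represent all contexts.
filter∈sublists : {X : Set} {P : X → Set} (P? : Decidable P) (xs : List X) →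
                  filter P? xs ∈ sublists xs
filter∈sublists P? []       = here refl
filter∈sublists P? (x ∷ xs) with P? x
... | yes _ = ∈-++⁺ˡ (∈-map⁺ (x ∷_) (filter∈sublists P? xs))
... | no  _ = ∈-++⁺ʳ (map (x ∷_) (sublists xs)) (filter∈sublists P? xs)

-- Hilbert-style deduction from contexts.

module _ {Atom : Set} where

  infix 3 _⊢*_

  -- Hypotheses become antecedents, the head of the list innermost, so implication introduction
  -- holds by definition.
  _⊢*_ : List (Formula Atom) → Formula Atom → Set
  []      ⊢* φ = ⊢IM φ
  (ψ ∷ Γ) ⊢* φ = Γ ⊢* ψ ⇒ φ

  theorem : ∀ Γ {φ} → ⊢IM φ → Γ ⊢* φ
  theorem []      d = d
  theorem (ψ ∷ Γ) d = theorem Γ (mp (⇒-K _ ψ) d)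

  mp* : ∀ Γ {φ ψ} → Γ ⊢* φ ⇒ ψ → Γ ⊢* φ → Γ ⊢* ψ
  mp* []      d e = mp d e
  mp* (χ ∷ Γ) d e = mp* Γ (mp* Γ (theorem Γ (⇒-S _ _ _)) d) e

  apply : ∀ Γ {φ ψ} → ⊢IM φ ⇒ ψ → Γ ⊢* φ → Γ ⊢* ψ
  apply Γ d = mp* Γ (theorem Γ d)

  ⇒-refl : (φ : Formula Atom) → ⊢IM φ ⇒ φ
  ⇒-refl φ = mp (mp (⇒-S φ (φ ⇒ φ) φ) (⇒-K _ _)) (⇒-K φ φ)

  assumption : ∀ {Γ φ} → φ ∈ Γ → Γ ⊢* φ
  assumption {φ ∷ Γ} (here refl) = theorem Γ (⇒-refl φ)
  assumption {ψ ∷ Γ} (there m)   = apply Γ (⇒-K _ ψ) (assumption m)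

  -- The root is split off so that `here refl` proves `φ ∈ subformulas φ` for arbitrary `φ`.
  subformulas : Formula Atom → List (Formula Atom)
  subformulas⁺ : Formula Atom → List (Formula Atom)
  subformulas φ = φ ∷ subformulas⁺ φ
  subformulas⁺ (var p) = []
  subformulas⁺ bot     = []
  subformulas⁺ (φ ∧ ψ) = subformulas φ ++ subformulas ψ
  subformulas⁺ (φ ∨ ψ) = subformulas φ ++ subformulas ψ
  subformulas⁺ (φ ⇒ ψ) = subformulas φ ++ subformulas ψ
  subformulas⁺ (□ φ)   = subformulas φ
  subformulas⁺ (◇ φ)   = subformulas φ

-- Decidable equality of formulas.

module Equality {Atom : Set} (_≟A_ : DecidableEquality Atom) where

  -- Comparing tags first leaves only the seven diagonal cases.
  tag : Formula Atom → ℕ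
  tag (var _) = 0
  tag bot     = 1
  tag (_ ∧ _) = 2
  tag (_ ∨ _) = 3
  tag (_ ⇒ _) = 4
  tag (□ _)   = 5
  tag (◇ _)   = 6

  infix 4 _≟_
  _≟_ : DecidableEquality (Formula Atom)
  compare : ∀ φ ψ → tag φ ≡ tag ψ → Dec (φ ≡ ψ)

  φ ≟ ψ with tag φ ℕ.≟ tag ψ
  ... | yes eq = compare φ ψ eq
  ... | no neq = no (neq ∘ cong tag)

  compare (var p) (var q) refl = map′ (cong var) (λ { refl → refl }) (p ≟A q)
  compare bot bot refl = yes refl
  compare (φ ∧ ψ) (φ′ ∧ ψ′) refl =
    map′ (uncurry (cong₂ _∧_)) (λ { refl → refl , refl }) (φ ≟ φ′ ×-dec ψ ≟ ψ′)
  compare (φ ∨ ψ) (φ′ ∨ ψ′) refl =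
    map′ (uncurry (cong₂ _∨_)) (λ { refl → refl , refl }) (φ ≟ φ′ ×-dec ψ ≟ ψ′)
  compare (φ ⇒ ψ) (φ′ ⇒ ψ′) refl =
    map′ (uncurry (cong₂ _⇒_)) (λ { refl → refl , refl }) (φ ≟ φ′ ×-dec ψ ≟ ψ′)
  compare (□ φ) (□ φ′) refl = map′ (cong □_) (λ { refl → refl }) (φ ≟ φ′)
  compare (◇ φ) (◇ φ′) refl = map′ (cong ◇_) (λ { refl → refl }) (φ ≟ φ′)

-- Natural deduction over `Σ`: decidability, weakening, saturation.

module Derivability {Atom : Set} (_≟A_ : DecidableEquality Atom)
                    (Σ : List (Formula Atom)) where

  open Equality _≟A_ using (_≟_)
  open import Data.List.Membership.DecPropositional _≟_ using (_∈?_)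

  Ctx = List (Formula Atom)

  Rel : Set₁
  Rel = Ctx → Formula Atom → Set

  -- All modal rules sit here, their auxiliary formulas confined to `Σ` to keep the search finite.
  -- Side derivations start from `[ φ ]` or `φ ∷ ψ ∷ []` without `Γ`, since monotonicity applies
  -- only to provable implications.
  Intro : Rel → Rel
  Intro R Γ (var p) = ⊥
  Intro R Γ bot     = Any (λ φ → Any (λ ψ →
                        R Γ (□ φ) × R Γ (◇ ψ) × R (φ ∷ ψ ∷ []) bot) Σ) Σ
  Intro R Γ (φ ∧ ψ) = R Γ φ × R Γ ψ
  Intro R Γ (φ ∨ ψ) = R Γ φ ⊎ R Γ ψ
  Intro R Γ (φ ⇒ ψ) = R (φ ∷ Γ) ψ
  Intro R Γ (□ ψ)   = Any (λ φ → R Γ (□ φ) × R [ φ ] ψ) Σ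
  Intro R Γ (◇ ψ)   = R (□ top ∷ Γ) (◇ ψ) ⊎ Any (λ φ → R Γ (◇ φ) × R [ φ ] ψ) Σ

  -- The minor premises of the elimination rule for the first formula.
  Elim : Rel → Formula Atom → Rel
  Elim R (var p) Γ χ = ⊥
  Elim R bot     Γ χ = ⊤
  Elim R (φ ∧ ψ) Γ χ = R (φ ∷ ψ ∷ Γ) χ
  Elim R (φ ∨ ψ) Γ χ = R (φ ∷ Γ) χ × R (ψ ∷ Γ) χ
  Elim R (φ ⇒ ψ) Γ χ = R Γ φ × R (ψ ∷ Γ) χ
  Elim R (□ φ)   Γ χ = ⊥
  Elim R (◇ φ)   Γ χ = ⊥

  Step : Rel → Rel
  -- Asking for `χ ∈ Σ` in the axiom rule makes derivability depend only on the part of `Γ` inside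
  -- `Σ`.
  Step R Γ χ = (χ ∈ Σ × χ ∈ Γ) ⊎ Intro R Γ χ ⊎ Any (λ φ → R Γ φ × Elim R φ Γ χ) Σ

  Derivable : ℕ → Rel
  Derivable zero    Γ φ = ⊥
  -- The first summand makes derivability cumulative in the height, as `stabilises` requires.
  Derivable (suc k) Γ φ = Derivable k Γ φ ⊎ Step (Derivable k) Γ φ

  module _ {R : Rel} (R? : ∀ Γ φ → Dec (R Γ φ)) where

    intro? : ∀ Γ φ → Dec (Intro R Γ φ)
    intro? Γ (var p) = no id
    intro? Γ bot     = any? (λ φ → any? (λ ψ →
                         R? Γ (□ φ) ×-dec R? Γ (◇ ψ) ×-dec R? (φ ∷ ψ ∷ []) bot) Σ) Σ
    intro? Γ (φ ∧ ψ) = R? Γ φ ×-dec R? Γ ψ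
    intro? Γ (φ ∨ ψ) = R? Γ φ ⊎-dec R? Γ ψ
    intro? Γ (φ ⇒ ψ) = R? (φ ∷ Γ) ψ
    intro? Γ (□ ψ)   = any? (λ φ → R? Γ (□ φ) ×-dec R? [ φ ] ψ) Σ
    intro? Γ (◇ ψ)   = R? (□ top ∷ Γ) (◇ ψ) ⊎-dec
                       any? (λ φ → R? Γ (◇ φ) ×-dec R? [ φ ] ψ) Σ

    elim? : ∀ φ Γ χ → Dec (Elim R φ Γ χ)
    elim? (var p) Γ χ = no id
    elim? bot     Γ χ = yes tt
    elim? (φ ∧ ψ) Γ χ = R? (φ ∷ ψ ∷ Γ) χ
    elim? (φ ∨ ψ) Γ χ = R? (φ ∷ Γ) χ ×-dec R? (ψ ∷ Γ) χ
    elim? (φ ⇒ ψ) Γ χ = R? Γ φ ×-dec R? (ψ ∷ Γ) χ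
    elim? (□ φ)   Γ χ = no id
    elim? (◇ φ)   Γ χ = no id

    step? : ∀ Γ χ → Dec (Step R Γ χ)
    step? Γ χ = (χ ∈? Σ ×-dec χ ∈? Γ) ⊎-dec intro? Γ χ ⊎-dec
                any? (λ φ → R? Γ φ ×-dec elim? φ Γ χ) Σ

  derivable? : ∀ k Γ φ → Dec (Derivable k Γ φ)
  derivable? zero    Γ φ = no id
  derivable? (suc k) Γ φ = derivable? k Γ φ ⊎-dec step? (derivable? k) Γ φ

  infix 4 _⊑_
  _⊑_ : Ctx → Ctx → Set
  Γ ⊑ Δ = ∀ {φ} → φ ∈ Σ → φ ∈ Γ → φ ∈ Δ

  ⊑-cons : ∀ {Γ Δ φ} → Γ ⊑ Δ → φ ∷ Γ ⊑ φ ∷ Δ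
  ⊑-cons s m (here e)  = here e
  ⊑-cons s m (there n) = there (s m n)

  Weakening : Rel → Set
  Weakening R = ∀ {Γ Δ φ} → Γ ⊑ Δ → R Γ φ → R Δ φ

  module _ {R : Rel} (weaken : Weakening R) where

    intro-weaken : ∀ {Γ Δ} φ → Γ ⊑ Δ → Intro R Γ φ → Intro R Δ φ
    intro-weaken bot     s d = Any.map (Any.map λ (a , b , c) → weaken s a , weaken s b , c) d
    intro-weaken (φ ∧ ψ) s (d , e) = weaken s d , weaken s e
    intro-weaken (φ ∨ ψ) s d = Sum.map (weaken s) (weaken s) d
    intro-weaken (φ ⇒ ψ) s d = weaken (⊑-cons s) d
    intro-weaken (□ ψ)   s d = Any.map (λ (a , b) → weaken s a , b) d
    intro-weaken (◇ ψ)   s d =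
      Sum.map (weaken (⊑-cons s)) (Any.map λ (a , b) → weaken s a , b) d

    elim-weaken : ∀ {Γ Δ χ} φ → Γ ⊑ Δ → Elim R φ Γ χ → Elim R φ Δ χ
    elim-weaken bot     s d = tt
    elim-weaken (φ ∧ ψ) s d = weaken (⊑-cons (⊑-cons s)) d
    elim-weaken (φ ∨ ψ) s (d , e) = weaken (⊑-cons s) d , weaken (⊑-cons s) e
    elim-weaken (φ ⇒ ψ) s (d , e) = weaken s d , weaken (⊑-cons s) e

    step-weaken : Weakening (Step R)
    step-weaken s (inj₁ (m , n)) = inj₁ (m , s m n)
    step-weaken {φ = φ} s (inj₂ (inj₁ d)) = inj₂ (inj₁ (intro-weaken φ s d))
    step-weaken s (inj₂ (inj₂ d)) =
      inj₂ (inj₂ (Any.map (λ {φ} (a , b) → weaken s a , elim-weaken φ s b) d))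

  derivable-weaken : ∀ k → Weakening (Derivable k)
  derivable-weaken (suc k) s =
    Sum.map (derivable-weaken k s) (step-weaken (derivable-weaken k) s)

  -- Cutting `Γ` down to its members in `Σ` does not change what it derives, so it suffices to
  -- stabilise on the finitely many pairs of a sublist of `Σ` and a formula of `Σ`.
  saturation : ∃[ K ] ∀ {Γ φ} → φ ∈ Σ → Step (Derivable K) Γ φ → Derivable K Γ φ
  saturation with stabilises {P = λ k (Γ , φ) → Derivable k Γ φ}
                    (λ k (Γ , φ) → derivable? k Γ φ) inj₁
                    (cartesianProduct (sublists Σ) Σ)
  ... | K , stable = K , closed
    where
    closed : ∀ {Γ φ} → φ ∈ Σ → Step (Derivable K) Γ φ → Derivable K Γ φ
    closed {Γ} φ∈Σ d =
      derivable-weaken K (λ _ → proj₂ ∘ ∈-filter⁻ (_∈? Γ) {xs = Σ})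
        (stable (∈-cartesianProduct⁺ (filter∈sublists (_∈? Γ) Σ) φ∈Σ)
          (derivable-weaken (suc K) (∈-filter⁺ (_∈? Γ)) (inj₂ d)))

  -- Soundness of the restricted calculus for `IM`.

  module _ {R : Rel} (sound : ∀ {Γ φ} → R Γ φ → Γ ⊢* φ) where

    intro-sound : ∀ Γ φ → Intro R Γ φ → Γ ⊢* φ
    intro-sound Γ bot d with Any.satisfied d
    ... | φ , e with Any.satisfied e
    ...   | ψ , a , b , c =
      -- `sound c` is a proof of `ψ ⇒ ∼ φ`, which turns `◇ ψ` into `◇ ∼ φ`.
      apply Γ (□◇-⊥ φ)
        (mp* Γ (apply Γ (∧-I _ _) (sound a)) (apply Γ (◇-mon (sound c)) (sound b)))
    intro-sound Γ (φ ∧ ψ) (d , e)  = mp* Γ (apply Γ (∧-I φ ψ) (sound d)) (sound e)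
    intro-sound Γ (φ ∨ ψ) (inj₁ d) = apply Γ (∨-I₁ φ ψ) (sound d)
    intro-sound Γ (φ ∨ ψ) (inj₂ d) = apply Γ (∨-I₂ φ ψ) (sound d)
    intro-sound Γ (φ ⇒ ψ) d        = sound d
    intro-sound Γ (□ ψ) d with Any.satisfied d
    ... | φ , a , b = apply Γ (□-mon (sound b)) (sound a)
    intro-sound Γ (◇ ψ) (inj₁ d)   = apply Γ (□⊤-◇ ψ) (sound d)
    intro-sound Γ (◇ ψ) (inj₂ d) with Any.satisfied d
    ... | φ , a , b = apply Γ (◇-mon (sound b)) (sound a)

    elim-sound : ∀ Γ φ χ → Γ ⊢* φ → Elim R φ Γ χ → Γ ⊢* χ
    elim-sound Γ bot     χ d _ = apply Γ (bot-E χ) d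
    elim-sound Γ (φ ∧ ψ) χ d e =
      mp* Γ (mp* Γ (sound e) (apply Γ (∧-E₂ φ ψ) d)) (apply Γ (∧-E₁ φ ψ) d)
    elim-sound Γ (φ ∨ ψ) χ d (e , f) =
      mp* Γ (mp* Γ (apply Γ (∨-E φ ψ χ) (sound e)) (sound f)) d
    elim-sound Γ (φ ⇒ ψ) χ d (e , f) = mp* Γ (sound f) (mp* Γ d (sound e))

  derivable-sound : ∀ k {Γ φ} → Derivable k Γ φ → Γ ⊢* φ
  derivable-sound (suc k)     (inj₁ d)                      = derivable-sound k d
  derivable-sound (suc k)     (inj₂ (inj₁ (_ , m)))         = assumption m
  derivable-sound (suc k) {Γ} (inj₂ (inj₂ (inj₁ d)))        =
    intro-sound (derivable-sound k) Γ _ d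
  derivable-sound (suc k) {Γ} (inj₂ (inj₂ (inj₂ d))) with Any.satisfied d
  ... | φ , a , b = elim-sound (derivable-sound k) Γ φ _ (derivable-sound k a) b

  -- The model of closed sets of contexts.

  module Model (□top⊆Σ : subformulas (□ top) ⊆ Σ)
               (R : Rel) (weaken : Weakening R)
               (closed : ∀ {Γ φ} → φ ∈ Σ → Step R Γ φ → R Γ φ) where

    infix 4 _⊢_
    _⊢_ : Rel
    _⊢_ = R

    □top∈Σ : □ top ∈ Σ
    □top∈Σ = □top⊆Σ (here refl)

    top∈Σ : top ∈ Σ
    top∈Σ = □top⊆Σ (there (here refl))

    bot∈Σ : bot ∈ Σ
    bot∈Σ = □top⊆Σ (there (there (here refl)))

    extend : ∀ {Γ Δ φ} → Γ ⊆ Δ → Γ ⊢ φ → Δ ⊢ φ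
    extend s = weaken (λ _ → s)

    axiom : ∀ {Γ φ} → φ ∈ Σ → φ ∈ Γ → Γ ⊢ φ
    axiom m n = closed m (inj₁ (m , n))

    intro : ∀ {Γ φ} → φ ∈ Σ → Intro _⊢_ Γ φ → Γ ⊢ φ
    intro m d = closed m (inj₂ (inj₁ d))

    elim : ∀ {Γ φ χ} → φ ∈ Σ → χ ∈ Σ → Γ ⊢ φ → Elim _⊢_ φ Γ χ → Γ ⊢ χ
    elim m n d e = closed n (inj₂ (inj₂ (lose m (d , e))))

    Pred : Set₁
    Pred = Ctx → Set

    -- A nucleus on upward closed sets, written as a continuation monad with answer formula `χ`.
    -- Quantifying over `Δ` builds in upward closure.
    Cl : Pred → Pred
    Cl A Γ = ∀ {Δ χ} → Γ ⊆ Δ → χ ∈ Σ → (∀ {Θ} → Δ ⊆ Θ → A Θ → Θ ⊢ χ) → Δ ⊢ χ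

    record Closed (A : Pred) : Set where
      field
        up : ∀ {Γ Δ} → Γ ⊆ Δ → A Γ → A Δ
        cl : ∀ {Γ} → Cl A Γ → A Γ
    open Closed

    Cl-up : ∀ A {Γ Δ} → Γ ⊆ Δ → Cl A Γ → Cl A Δ
    Cl-up A s c t = c (t ∘ s)

    Cl-bind : ∀ A B {Γ} → (∀ {Δ} → Γ ⊆ Δ → A Δ → Cl B Δ) → Cl A Γ → Cl B Γ
    Cl-bind A B f c s m k = c s m λ t a → f (t ∘ s) a id m (λ u → k (u ∘ t))

    Cl-return : ∀ A {Γ} → (∀ {Δ} → Γ ⊆ Δ → A Δ) → Cl A Γ
    Cl-return A a s m k = k id (a s)

    Cl-run : ∀ A {Γ χ} → χ ∈ Σ → (∀ {Δ} → Γ ⊆ Δ → A Δ → Δ ⊢ χ) → Cl A Γ → Γ ⊢ χ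
    Cl-run A m k c = c id m k

    -- Of the three, only `Or` is wrapped in `Cl`: a union of closed sets need not be closed.
    Imp And Or : Pred → Pred → Pred
    Imp A B Γ = ∀ {Δ} → Γ ⊆ Δ → A Δ → B Δ
    And A B Γ = A Γ × B Γ
    Or A B = Cl (λ Γ → A Γ ⊎ B Γ)

    -- The least monotone extension of `○` from formulas of `Σ` to predicates: `φ` approximates `A`
    -- from inside.
    Below : (Formula Atom → Formula Atom) → Pred → Pred
    Below ○ A Γ = Σ[ φ ∈ Formula Atom ]
                  φ ∈ Σ × ○ φ ∈ Σ × (∀ {Δ} → Δ ⊢ φ → A Δ) × Γ ⊢ ○ φ

    Box Dia : Pred → Pred
    Box A = Cl (Below □_ A)
    Dia A = Imp (_⊢ □ top) (Cl (Below ◇_ A))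

    Below-mon : ∀ ○ A B → (∀ {Γ} → A Γ → B Γ) → ∀ {Γ} → Below ○ A Γ → Cl (Below ○ B) Γ
    Below-mon ○ A B h (φ , m , n , f , d) =
      Cl-return (Below ○ B) λ s → φ , m , n , h ∘ f , extend s d

    Cl-closed : ∀ A → Closed (Cl A)
    Cl-closed A .up = Cl-up A
    Cl-closed A .cl = Cl-bind (Cl A) A λ _ → id

    Imp-closed : ∀ A B → (∀ {Γ Δ} → Γ ⊆ Δ → A Γ → A Δ) → Closed B → Closed (Imp A B)
    Imp-closed A B upA cB .up s f t = f (t ∘ s)
    Imp-closed A B upA cB .cl c s a =
      cB .cl (Cl-bind (Imp A B) B
        (λ t f → Cl-return B λ u → f u (upA (u ∘ t) a)) (Cl-up (Imp A B) s c))

    And-closed : ∀ A B → Closed A → Closed B → Closed (And A B)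
    And-closed A B cA cB .up s (a , b) = cA .up s a , cB .up s b
    And-closed A B cA cB .cl c =
      cA .cl (Cl-bind (And A B) A (λ _ (a , _) → Cl-return A λ s → cA .up s a) c) ,
      cB .cl (Cl-bind (And A B) B (λ _ (_ , b) → Cl-return B λ s → cB .up s b) c)

    derives-closed : ∀ {φ} → φ ∈ Σ → Closed (_⊢ φ)
    derives-closed m .up = extend
    derives-closed m .cl = Cl-run _ m λ _ → id

    -- This makes `_⊢ bot` the least closed predicate, hence the right reading of `bot`.
    explode : ∀ A {Γ} → Γ ⊢ bot → Cl A Γ
    explode A d s m k = elim bot∈Σ m (extend s d) tt

    ⟦_⟧ : Formula Atom → (Atom → Pred) → Pred
    ⟦ var p ⟧ V = V p
    ⟦ bot   ⟧ V = _⊢ bot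
    ⟦ φ ∧ ψ ⟧ V = And (⟦ φ ⟧ V) (⟦ ψ ⟧ V)
    ⟦ φ ∨ ψ ⟧ V = Or (⟦ φ ⟧ V) (⟦ ψ ⟧ V)
    ⟦ φ ⇒ ψ ⟧ V = Imp (⟦ φ ⟧ V) (⟦ ψ ⟧ V)
    ⟦ □ φ   ⟧ V = Box (⟦ φ ⟧ V)
    ⟦ ◇ φ   ⟧ V = Dia (⟦ φ ⟧ V)

    -- Turns substitution into a change of valuation; `sound` ranges over all closed valuations so
    -- that its `us` case can recurse at the new one.
    ⟦sub⟧ : ∀ σ V φ → ⟦ sub σ φ ⟧ V ≡ ⟦ φ ⟧ (λ p → ⟦ σ p ⟧ V)
    ⟦sub⟧ σ V (var p) = refl
    ⟦sub⟧ σ V bot     = refl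
    ⟦sub⟧ σ V (φ ∧ ψ) = cong₂ And (⟦sub⟧ σ V φ) (⟦sub⟧ σ V ψ)
    ⟦sub⟧ σ V (φ ∨ ψ) = cong₂ Or (⟦sub⟧ σ V φ) (⟦sub⟧ σ V ψ)
    ⟦sub⟧ σ V (φ ⇒ ψ) = cong₂ Imp (⟦sub⟧ σ V φ) (⟦sub⟧ σ V ψ)
    ⟦sub⟧ σ V (□ φ)   = cong Box (⟦sub⟧ σ V φ)
    ⟦sub⟧ σ V (◇ φ)   = cong Dia (⟦sub⟧ σ V φ)

    ⟦⟧-closed : ∀ V → (∀ p → Closed (V p)) → ∀ φ → Closed (⟦ φ ⟧ V)
    ⟦⟧-closed V cV (var p) = cV p
    ⟦⟧-closed V cV bot     = derives-closed bot∈Σ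
    ⟦⟧-closed V cV (φ ∧ ψ) = And-closed _ _ (⟦⟧-closed V cV φ) (⟦⟧-closed V cV ψ)
    ⟦⟧-closed V cV (φ ∨ ψ) = Cl-closed _
    ⟦⟧-closed V cV (φ ⇒ ψ) = Imp-closed _ _ (⟦⟧-closed V cV φ .up) (⟦⟧-closed V cV ψ)
    ⟦⟧-closed V cV (□ φ)   = Cl-closed _
    ⟦⟧-closed V cV (◇ φ)   = Imp-closed _ _ extend (Cl-closed _)

    -- □ φ ⊢ □ ⊤ by monotonicity, which unlocks the implication in Dia.
    Box-Dia-bot : ∀ A {Γ} → Box A Γ → Dia (Imp A (_⊢ bot)) Γ → Γ ⊢ bot
    Box-Dia-bot A {Γ} b d = Cl-run (Below □_ A) bot∈Σ with-box b
      where
      with-box : ∀ {Δ} → Γ ⊆ Δ → Below □_ A Δ → Δ ⊢ bot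
      with-box {Δ} s (φ , m , n , f , e) =
        Cl-run (Below ◇_ (Imp A (_⊢ bot))) bot∈Σ with-dia (d s Δ⊢□top)
        where
        Δ⊢□top : Δ ⊢ □ top
        Δ⊢□top = intro □top∈Σ (lose m (e , intro top∈Σ (axiom bot∈Σ (here refl))))
        with-dia : ∀ {Θ} → Δ ⊆ Θ → Below ◇_ (Imp A (_⊢ bot)) Θ → Θ ⊢ bot
        with-dia t (ψ , m′ , n′ , g , e′) =
          -- `φ` lies inside `A` and `ψ` inside its negation, so the context `φ ∷ ψ ∷ []` derives
          -- `bot`, the last premise of the rule.
          intro bot∈Σ (lose m (lose m′ (extend t e , e′ ,
            g (axiom m′ (there (here refl))) id (f (axiom m (here refl))))))

    sound : ∀ V → (∀ p → Closed (V p)) → ∀ {φ} → ⊢IM φ → ∀ {Γ} → ⟦ φ ⟧ V Γ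
    sound V cV (⇒-K φ ψ) _ a t _ = ⟦⟧-closed V cV φ .up t a
    sound V cV (⇒-S φ ψ χ) _ f t g u a = f (u ∘ t) a id (g u a)
    sound V cV (∧-I φ ψ) _ a t b = ⟦⟧-closed V cV φ .up t a , b
    sound V cV (∧-E₁ φ ψ) _ = proj₁
    sound V cV (∧-E₂ φ ψ) _ = proj₂
    sound V cV (∨-I₁ φ ψ) _ a = Cl-return _ λ t → inj₁ (⟦⟧-closed V cV φ .up t a)
    sound V cV (∨-I₂ φ ψ) _ b = Cl-return _ λ t → inj₂ (⟦⟧-closed V cV ψ .up t b)
    sound V cV (∨-E φ ψ χ) _ f t g u c =
      ⟦⟧-closed V cV χ .cl (Cl-bind _ _ (λ v →
        Sum.[ (λ a → Cl-return _ λ w → ⟦⟧-closed V cV χ .up w (f (v ∘ u ∘ t) a))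
            , (λ b → Cl-return _ λ w → ⟦⟧-closed V cV χ .up w (g (v ∘ u) b)) ]) c)
    sound V cV (bot-E φ) _ d = ⟦⟧-closed V cV φ .cl (explode _ d)
    sound V cV (□◇-⊥ φ) _ (b , d) = Box-Dia-bot (⟦ φ ⟧ V) b d
    -- A derivation of `□ top` makes `□ top` true with `top` as its own witness; `f` then yields a
    -- `Dia`, unlocked by the same derivation.
    sound V cV (□⊤-◇ φ) _ f s d =
      f s (Cl-return (Below □_ (⟦ top ⟧ V)) λ t → top , top∈Σ , □top∈Σ , (λ _ _ → id) , extend t d) id d
    sound V cV (mp d e) = sound V cV d id (sound V cV e)
    -- A theorem holds at every context, so a provable implication is an inclusion of predicates.
    sound V cV (□-mon d) _ =
      Cl-bind (Below □_ _) (Below □_ _) λ _ → Below-mon □_ _ _ (λ {Γ} → sound V cV d {Γ} id)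
    sound V cV (◇-mon d) _ f s e =
      Cl-bind (Below ◇_ _) (Below ◇_ _) (λ _ → Below-mon ◇_ _ _ (λ {Γ} → sound V cV d {Γ} id)) (f s e)
    sound V cV (us {φ} σ d) {Γ} =
      subst (λ A → A Γ) (sym (⟦sub⟧ σ V φ))
        (sound (λ p → ⟦ σ p ⟧ V) (λ p → ⟦⟧-closed V cV (σ p)) d)

    -- The canonical valuation and the truth lemma.

    V₀ : Atom → Pred
    -- The guard keeps the valuation closed at letters outside `Σ`, about which `Cl` says nothing.
    V₀ p Γ = var p ∈ Σ → Γ ⊢ var p

    V₀-closed : ∀ p → Closed (V₀ p)
    V₀-closed p .up s f m = extend s (f m)
    V₀-closed p .cl c m = Cl-run _ m (λ _ f → f m) c

    -- The two halves of the truth lemma, mutual because an implication swaps them at its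
    -- antecedent.
    reflect : ∀ φ → subformulas φ ⊆ Σ → ∀ {Γ} → Γ ⊢ φ → ⟦ φ ⟧ V₀ Γ
    reify   : ∀ φ → subformulas φ ⊆ Σ → ∀ {Γ} → ⟦ φ ⟧ V₀ Γ → Γ ⊢ φ

    module _ (φ ψ : Formula Atom) {χ} (s : χ ∷ subformulas φ ++ subformulas ψ ⊆ Σ) where
      left : subformulas φ ⊆ Σ
      left = s ∘ there ∘ ∈-++⁺ˡ
      right : subformulas ψ ⊆ Σ
      right = s ∘ there ∘ ∈-++⁺ʳ (subformulas φ)

    reflect (var p) s d _ = d
    reflect bot     s d = d
    reflect (φ ∧ ψ) s d =
      reflect φ (left φ ψ s) (elim (s (here refl)) (left φ ψ s (here refl)) d
        (axiom (left φ ψ s (here refl)) (here refl))) ,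
      reflect ψ (right φ ψ s) (elim (s (here refl)) (right φ ψ s (here refl)) d
        (axiom (right φ ψ s (here refl)) (there (here refl))))
    -- The continuation `k` supplies both branches of a disjunction elimination whose conclusion is
    -- the answer formula.
    reflect (φ ∨ ψ) s d t m k =
      elim (s (here refl)) m (extend t d)
        ( k there (inj₁ (reflect φ (left φ ψ s) (axiom (left φ ψ s (here refl)) (here refl))))
        , k there (inj₂ (reflect ψ (right φ ψ s) (axiom (right φ ψ s (here refl)) (here refl)))))
    reflect (φ ⇒ ψ) s d t a =
      reflect ψ (right φ ψ s) (elim (s (here refl)) (right φ ψ s (here refl)) (extend t d)
        (reify φ (left φ ψ s) a , axiom (right φ ψ s (here refl)) (here refl)))
    reflect (□ φ) s d = Cl-return (Below □_ (⟦ φ ⟧ V₀)) λ t →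
      φ , s (there (here refl)) , s (here refl) , reflect φ (s ∘ there) , extend t d
    reflect (◇ φ) s d t _ = Cl-return (Below ◇_ (⟦ φ ⟧ V₀)) λ u →
      φ , s (there (here refl)) , s (here refl) , reflect φ (s ∘ there) , extend (u ∘ t) d

    reify (var p) s a = a (s (here refl))
    reify bot     s d = d
    reify (φ ∧ ψ) s (a , b) =
      intro (s (here refl)) (reify φ (left φ ψ s) a , reify ψ (right φ ψ s) b)
    reify (φ ∨ ψ) s c = Cl-run _ (s (here refl))
      (λ _ → intro (s (here refl)) ∘ Sum.map (reify φ (left φ ψ s)) (reify ψ (right φ ψ s))) c
    reify (φ ⇒ ψ) s f = intro (s (here refl)) (reify ψ (right φ ψ s)
      (f there (reflect φ (left φ ψ s) (axiom (left φ ψ s (here refl)) (here refl)))))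
    -- Evaluating the witness's inclusion at the one-formula context `[ ψ ]` gives the premise of
    -- monotonicity.
    reify (□ φ) s c = Cl-run (Below □_ (⟦ φ ⟧ V₀)) (s (here refl))
      (λ _ (ψ , m , _ , f , d) → intro (s (here refl))
        (lose m (d , reify φ (s ∘ there) (f (axiom m (here refl)))))) c
    -- The first `◇` rule adds `□ top` to the context, which unlocks `f`; the rest is as for `□`.
    reify (◇ φ) s f = intro (s (here refl)) (inj₁ (Cl-run (Below ◇_ (⟦ φ ⟧ V₀)) (s (here refl))
      (λ _ (ψ , m , _ , g , d) → intro (s (here refl))
        (inj₂ (lose m (d , reify φ (s ∘ there) (g (axiom m (here refl)))))))
      (f there (axiom □top∈Σ (here refl)))))

    complete : ∀ φ → subformulas φ ⊆ Σ → ⊢IM φ → ∀ {Γ} → Γ ⊢ φ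
    complete φ s d = reify φ s (sound V₀ V₀-closed d)

theorem3p14 : (Atom : Set) → DecidableEquality Atom →
    (φ : Formula Atom) → Dec (⊢IM φ)
theorem3p14 Atom _≟A_ φ =
  -- At the empty context `⊢*` unfolds to `⊢IM`, so soundness applies directly.
  map′ (derivable-sound K) (λ d → complete φ ∈-++⁺ˡ d) (derivable? K [] φ)
  where
  -- A rule for `◇` assumes `□ top`, so it, `top` and `bot` are put in `Σ` even when they do not
  -- occur in `φ`.
  open Derivability _≟A_ (subformulas φ ++ subformulas (□ top))
  K = proj₁ saturation
  open Model (∈-++⁺ʳ (subformulas φ)) (Derivable K) (derivable-weaken K) (proj₂ saturation)
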